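{- Let $n$ and $r\ge 2$ be integers. The maximum independence number of an almost self-centered graph of order $n$ and radius $r$ is $n-r$.
   Context: All graphs are finite and simple. For a connected graph $G$, the eccentricity of a vertex $v$ is $\max_{u\in V(G)} d(v,u)$; the radius is the minimum eccentricity. A central vertex is one whose eccentricity equals the radius. A connected graph of order $n$ is almost self-centered if it has exactly $n-2$ central vertices. The independence number is the maximum size of a set of pairwise nonadjacent vertices. -}

module Defs where

open import Data.Nat using (ℕ; zero; suc; _≤_; _∸_)
open import Data.Fin using (Fin)
open import Data.Fin.Subset using (Subset; _∈_; ∣_∣)
open import Data.Product using (Σ; ∃; _×_; _,_)
open import Data.Empty using (⊥)
open import Relation.Nullary using (¬_)
open import Relation.Binary.PropositionalEquality using (_≡_)
open import Function.Bundles using (_⇔_)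

record Graph (n : ℕ) : Set₁ where
  field
    Adj   : Fin n → Fin n → Set
    sym   : ∀ {u v} → Adj u v → Adj v u
    irrefl : ∀ {v} → ¬ Adj v v
open Graph public

module _ {n : ℕ} (G : Graph n) where

  data Walk : Fin n → Fin n → ℕ → Set where
    here : ∀ {v} → Walk v v 0
    step : ∀ {u v w k} → Adj G u v → Walk v w k → Walk u w (suc k)

  Connected : Set
  Connected = ∀ u v → ∃ λ k → Walk u v k

  Ecc : Fin n → ℕ → Set
  Ecc v e = (∀ u → ∃ λ k → k ≤ e × Walk v u k)
          × (∃ λ u → ∀ k → Walk v u k → e ≤ k)

  Radius : ℕ → Set
  Radius r = (∃ λ v → Ecc v r) × (∀ v e → Ecc v e → r ≤ e)

  Central : Fin n → Set
  Central v = ∀ r → Radius r → Ecc v r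

  AlmostSelfCentered : Set
  AlmostSelfCentered =
    Connected × Σ (Subset n) λ S → (∣ S ∣ ≡ n ∸ 2) × (∀ v → (v ∈ S) ⇔ Central v)

  Independent : Subset n → Set
  Independent S = ∀ u v → u ∈ S → v ∈ S → ¬ Adj G u v

  IndepNum : ℕ → Set
  IndepNum a = (Σ (Subset n) λ S → Independent S × ∣ S ∣ ≡ a)
             × (∀ S → Independent S → ∣ S ∣ ≤ a)

{-# OPTIONS --safe #-}
module Submission where

-- Upper bound: let S be independent and c = ∣ ∁ S ∣. Consecutive vertices of ∁ S on a walk are at
-- distance at most 2, so ∁ S can be exhausted one vertex at a time, each new vertex within distance 2
-- of an old one; moving a centre one step towards the new vertex raises the radius of the covered
-- set by one. In the end some vertex is within c − 1 of ∁ S, hence within c of everything, so r ≤ c.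
--
-- Attainment: the two non-central vertices x, y are at distance r + 1. In the layering by distance
-- from x, a single-vertex layer strictly between the levels 1 and r would force a distance above
-- r + 1, and if r ≥ 3 the levels 1 and r are not both single vertices, whence n ≥ 2r + 1. For those
-- n, take the cycle of length 2r with a pendant vertex at 0 and n − 2r − 1 twins of 1; the odd
-- vertices, the pendant vertex and the twins are independent. The only other case is r = 2, n = 4,
-- attained by a path.

open import Defs
open import Data.Nat using (ℕ; zero; suc; _+_; _*_; _⊓_; ∣_-_∣; _≤_; _<_; _∸_; z≤n; s≤s; _≤?_; _<?_)
open import Data.Nat.Properties
open import Data.Nat.Induction using (<-rec)
open import Relation.Binary.Definitions using (tri<; tri≈; tri>)
open import Data.Bool using (true; false)
open import Data.Fin using (Fin; zero; suc; toℕ; fromℕ<; inject₁)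
import Data.Fin.Properties as Fin
open import Data.Fin.Subset using (Subset; inside; outside; _∈_; _∉_; ∣_∣; ∁; ⊤; _∪_; ⁅_⁆)
  renaming (⊥ to ∅; _-_ to _∖_)
open import Data.Fin.Subset.Properties
open import Data.Product using (Σ; ∃; _×_; _,_; proj₁; proj₂)
open import Data.Sum using (_⊎_; inj₁; inj₂; swap)
open import Data.Vec using ([]; _∷_; here; there)
open import Data.Empty using (⊥; ⊥-elim)
open import Effect.Monad using (module RawMonad)
open import Function.Base using (_∘_)
open import Function.Bundles using (mk⇔; module Equivalence)
open import Relation.Nullary using (¬_; yes; no; contradiction)
open import Relation.Nullary.Decidable using (decidable-stable; ¬?; _×-dec_)
open import Relation.Nullary.Negation using (¬¬-Monad; ¬¬-map)
import Relation.Binary.PropositionalEquality as ≡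
open ≡ using (_≡_; _≢_; refl; cong; subst)

-- Cardinalities of subsets and maxima

∣p∣<∣p∪⁅x⁆∣ : ∀ {n} {p : Subset n} {x} → x ∉ p → ∣ p ∣ < ∣ p ∪ ⁅ x ⁆ ∣
∣p∣<∣p∪⁅x⁆∣ {p = p} {x} x∉p =
  p⊂q⇒∣p∣<∣q∣ (p⊆p∪q ⁅ x ⁆ , x , q⊆p∪q p ⁅ x ⁆ (x∈⁅x⁆ x) , x∉p)

∣p∪⁅x⁆∣≤1+∣p∣ : ∀ {n} (p : Subset n) x → ∣ p ∪ ⁅ x ⁆ ∣ ≤ suc ∣ p ∣
∣p∪⁅x⁆∣≤1+∣p∣ (s ∷ p) zero rewrite ∪-identityʳ p with s
... | true  = n≤1+n _
... | false = ≤-refl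
∣p∪⁅x⁆∣≤1+∣p∣ (true  ∷ p) (suc x) = s≤s (∣p∪⁅x⁆∣≤1+∣p∣ p x)
∣p∪⁅x⁆∣≤1+∣p∣ (false ∷ p) (suc x) = ∣p∪⁅x⁆∣≤1+∣p∣ p x

maximum : ∀ {n} (f : Fin (suc n) → ℕ) → ∃ λ i → ∀ j → f j ≤ f i
maximum {zero}  f = zero , λ { zero → ≤-refl }
maximum {suc n} f with maximum (f ∘ suc)
... | i , fj≤fi with ≤-total (f zero) (f (suc i))
... | inj₁ f0≤ = suc i , λ { zero → f0≤ ; (suc j) → fj≤fi j }
... | inj₂ ≤f0 = zero , λ { zero → ≤-refl ; (suc j) → ≤-trans (fj≤fi j) ≤f0 }

-- Walks and distances

module _ {n : ℕ} (G : Graph n) where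

  -- `Near` and `Far` are the two halves of `Ecc`, so that both can be handled without a distance
  -- function.
  Near : ℕ → Fin n → Fin n → Set
  Near m u v = ∃ λ k → k ≤ m × Walk G u v k

  Far : ℕ → Fin n → Fin n → Set
  Far m u v = ∀ k → Walk G u v k → m ≤ k

module _ {n : ℕ} {G : Graph n} where

  infixr 5 _++_

  _++_ : ∀ {u v w j k} → Walk G u v j → Walk G v w k → Walk G u w (j + k)
  here     ++ q = q
  step e p ++ q = step e (p ++ q)

  snoc : ∀ {u v w k} → Walk G u v k → Adj G v w → Walk G u w (suc k)
  snoc here       e = step e here
  snoc (step f p) e = step f (snoc p e)

  reverse : ∀ {u v k} → Walk G u v k → Walk G v u k
  reverse here       = here
  reverse (step e p) = snoc (reverse p) (sym G e)

  Near-mono : ∀ {u v l m} → l ≤ m → Near G l u v → Near G m u v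
  Near-mono l≤m (k , k≤l , p) = k , ≤-trans k≤l l≤m , p

  Near-sym : ∀ {u v m} → Near G m u v → Near G m v u
  Near-sym (k , k≤m , p) = k , k≤m , reverse p

  Near-trans : ∀ {u v w l m} → Near G l u v → Near G m v w → Near G (l + m) u w
  Near-trans (j , j≤l , p) (k , k≤m , q) = j + k , +-mono-≤ j≤l k≤m , p ++ q

  Near-adj : ∀ {u v} → Adj G u v → Near G 1 u v
  Near-adj e = 1 , ≤-refl , step e here

  Radius-unique : ∀ {r s} → Radius G r → Radius G s → r ≡ s
  Radius-unique ((u , eu) , minr) ((v , ev) , mins) = ≤-antisym (minr v _ ev) (mins u _ eu)

record Distance {n : ℕ} (G : Graph n) : Set where
  field
    d     : Fin n → Fin n → ℕ
    walk  : ∀ u v → Walk G u v (d u v)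
    least : ∀ {u v k} → Walk G u v k → d u v ≤ k

-- A distance function exists only up to double negation, adjacency being undecidable in general.
¬¬-distance : ∀ {n} {G : Graph n} → Connected G → ¬ ¬ Distance G
¬¬-distance {n} {G} conn = ¬¬-map toDistance
  (sequence λ u → sequence λ v → ¬¬shortest (proj₂ (conn u v)))
  where
  sequence : ∀ {P : Fin n → Set} → (∀ i → ¬ ¬ P i) → ¬ ¬ (∀ i → P i)
  sequence = Fin.sequence (RawMonad.rawApplicative ¬¬-Monad)

  Shortest : Fin n → Fin n → Set
  Shortest u v = ∃ λ k → Walk G u v k × (∀ {j} → Walk G u v j → k ≤ j)

  ¬¬shortest : ∀ {u v k} → Walk G u v k → ¬ ¬ Shortest u v
  ¬¬shortest {u} {v} {k} p none = <-rec (λ j → ¬ Walk G u v j)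
    (λ j rec q → none (j , q , λ q′ → ≮⇒≥ λ i<j → rec i<j q′)) k p

  toDistance : (∀ u v → Shortest u v) → Distance G
  toDistance s = record
    { d     = λ u v → proj₁ (s u v)
    ; walk  = λ u v → proj₁ (proj₂ (s u v))
    ; least = λ {u} {v} → proj₂ (proj₂ (s u v))
    }

module DistanceProperties {n : ℕ} {G : Graph n} (D : Distance G) where
  open Distance D public

  d-refl : ∀ u → d u u ≡ 0
  d-refl u = n≤0⇒n≡0 (least here)

  d-sym : ∀ u v → d u v ≡ d v u
  d-sym u v = ≤-antisym (least (reverse (walk v u))) (least (reverse (walk u v)))

  d-triangle : ∀ u v w → d u w ≤ d u v + d v w
  d-triangle u v w = least (walk u v ++ walk v w)

  d>0⇒≢ : ∀ {u v} → 0 < d u v → u ≢ v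
  d>0⇒≢ {u} 0<d refl = <⇒≢ 0<d (≡.sym (d-refl u))

  eccentricity-≤ : ∀ {v e} → Ecc G v e → ∀ u → d v u ≤ e
  eccentricity-≤ (near , _) u with near u
  ... | k , k≤e , p = ≤-trans (least p) k≤e

  eccentricity-attained : ∀ {v e} → Ecc G v e → ∃ λ u → d v u ≡ e
  eccentricity-attained {v} ev@(_ , u , far) =
    u , ≤-antisym (eccentricity-≤ ev u) (far _ (walk v u))

  eccentricity : ∀ v → ∃ (Ecc G v)
  eccentricity v = go v (d v) (walk v) least
    where
    -- Stated for every order, so that the order can be matched as a successor.
    go : ∀ {n} {G : Graph n} (v : Fin n) (f : Fin n → ℕ) → (∀ u → Walk G v u (f u)) →
         (∀ {u k} → Walk G v u k → f u ≤ k) → ∃ (Ecc G v)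
    go {suc _} v f walk least with maximum f
    ... | i , fj≤fi = f i , (λ u → f u , fj≤fi u , walk u) , i , λ _ → least

  -- `Radius` compares only with exact eccentricities, so the eccentricity of `v` is taken first; it
  -- is at most `m`.
  radius≤ : ∀ {r m} → Radius G r → ∀ v → (∀ u → Near G m v u) → r ≤ m
  radius≤ {m = m} (_ , minr) v near with eccentricity v
  ... | e , ev with eccentricity-attained ev
  ... | u , refl with near u
  ... | k , k≤m , p = ≤-trans (minr v _ ev) (≤-trans (least p) k≤m)

  -- The distance from `x` grows by at most one per edge, so a shortest walk from `u` to `v` cannot
  -- jump over level `i`.
  crossing : ∀ x i u v → d x u ≤ i → i ≤ d x v → ∃ λ w → d x w ≡ i × d u w + d w v ≤ d u v
  crossing x i u v du≤i i≤dv = go (walk u v) du≤i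
    where
    go : ∀ {u k} → Walk G u v k → d x u ≤ i → ∃ λ w → d x w ≡ i × d u w + d w v ≤ k
    go {u} p du≤i with m≤n⇒m<n∨m≡n du≤i
    go {u} p _ | inj₂ du≡i = u , du≡i , +-mono-≤ (least here) (least p)
    go here _ | inj₁ du<i = contradiction i≤dv (<⇒≱ du<i)
    go {u} (step {v = u′} e p) _ | inj₁ du<i
      with go p (≤-trans (least (snoc (walk x u) e)) du<i)
    ... | w , dw≡i , dw≤ = w , dw≡i ,
      ≤-trans (+-monoˡ-≤ (d w v) (least (step e (walk u′ w)))) (s≤s dw≤)

-- Independent sets

module _ {n : ℕ} {G : Graph n} (conn : Connected G) {S : Subset n} (ind : Independent G S) where

  -- By independence a walk never stays outside ∁ S for two consecutive vertices.
  exit : ∀ {P : Subset n} {u w k} → (∀ {v} → v ∈ P → v ∉ S) → Walk G u w k →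
         u ∈ P → w ∉ P → w ∉ S → ∃ λ x → ∃ λ y → x ∈ P × y ∉ P × y ∉ S × Near G 2 x y
  exit P∩S here u∈P w∉P _ = contradiction u∈P w∉P
  exit {P} P∩S (step {u} {v} e p) u∈P w∉P w∉S with v ∈? P | v ∈? S
  ... | yes v∈P | _ = exit P∩S p v∈P w∉P w∉S
  ... | no v∉P | no v∉S = u , v , u∈P , v∉P , v∉S , 1 , s≤s z≤n , step e here
  exit P∩S (step e here) u∈P w∉P w∉S | no _ | yes v∈S = contradiction v∈S w∉S
  exit {P} P∩S (step {u} {v} e (step {v = v′} e′ p)) u∈P w∉P w∉S | no _ | yes v∈S
    with v′ ∈? P | v′ ∈? S
  ... | _ | yes v′∈S = ⊥-elim (ind v v′ v∈S v′∈S e′)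
  ... | yes v′∈P | _ = exit P∩S p v′∈P w∉P w∉S
  ... | no v′∉P | no v′∉S =
    u , v′ , u∈P , v′∉P , v′∉S , 2 , ≤-refl , step e (step e′ here)

  -- Moving the centre one step towards a new vertex costs one unit of radius but gains two of reach.
  recentre : ∀ {P : Subset n} {m z x y} → (∀ {v} → v ∈ P → Near G m z v) → x ∈ P → Near G 2 x y →
             ∃ λ z′ → ∀ {v} → v ∈ P ∪ ⁅ y ⁆ → Near G (suc m) z′ v
  recentre {P} {m} {z} {x} {y} near x∈P xy with Near-trans (near x∈P) xy
  ... | _ , _ , here = z , λ {v} v∈ → case v (x∈p∪q⁻ P ⁅ y ⁆ v∈)
    where
    case : ∀ v → v ∈ P ⊎ v ∈ ⁅ y ⁆ → Near G (suc m) z v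
    case v (inj₁ v∈P) = Near-mono (n≤1+n m) (near v∈P)
    case v (inj₂ v∈y) with x∈⁅y⁆⇒x≡y y v∈y
    ... | refl = 0 , z≤n , here
  ... | suc k , k≤ , step {v = z′} e p = z′ , λ {v} v∈ → case v (x∈p∪q⁻ P ⁅ y ⁆ v∈)
    where
    case : ∀ v → v ∈ P ⊎ v ∈ ⁅ y ⁆ → Near G (suc m) z′ v
    case v (inj₁ v∈P) = Near-trans (Near-adj (sym G e)) (near v∈P)
    case v (inj₂ v∈y) with x∈⁅y⁆⇒x≡y y v∈y
    ... | refl = k , ≤-pred (subst (suc k ≤_) (+-comm m 2) k≤) , p

  ∁-centre : ∀ {c} → c ∉ S →
             ∃ λ m → ∃ λ z → m < ∣ ∁ S ∣ × (∀ {v} → v ∉ S → Near G m z v)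
  ∁-centre {c} c∉S = grow ∣ ∁ S ∣ ⁅ c ⁆ 0 c (x∈⁅x⁆ c)
    (λ v∈c → subst (_∉ S) (≡.sym (x∈⁅y⁆⇒x≡y c v∈c)) c∉S)
    (≤-reflexive (≡.sym (∣⁅x⁆∣≡1 c)))
    (λ v∈c → 0 , z≤n , subst (λ v → Walk G c v 0) (≡.sym (x∈⁅y⁆⇒x≡y c v∈c)) here)
    (≤-reflexive (≡.sym (+-identityʳ _)))
    where
    -- Each round adds one vertex to `P` and one to `m`, which preserves `m < ∣ P ∣`; `k` bounds the
    -- rounds left.
    grow : ∀ k P m z → c ∈ P → (∀ {v} → v ∈ P → v ∉ S) → m < ∣ P ∣ →
           (∀ {v} → v ∈ P → Near G m z v) → ∣ ∁ S ∣ ≤ k + m →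
           ∃ λ m → ∃ λ z → m < ∣ ∁ S ∣ × (∀ {v} → v ∉ S → Near G m z v)
    grow k P m z c∈P P∩S m<P near fuel
      with Fin.any? (λ w → ¬? (w ∈? S) ×-dec ¬? (w ∈? P))
    ... | no none = m , z , m<∁S , λ {v} v∉S →
      near (decidable-stable (v ∈? P) λ v∉P → none (v , v∉S , v∉P))
      where
      m<∁S : m < ∣ ∁ S ∣
      m<∁S = ≤-trans m<P (p⊆q⇒∣p∣≤∣q∣ (x∉p⇒x∈∁p ∘ P∩S))
    -- Out of fuel: `∣ ∁ S ∣ ≤ m < ∣ P ∣ ≤ ∣ ∁ S ∣`.
    grow zero P m z c∈P P∩S m<P near fuel | yes _ =
      contradiction (≤-trans m<P (≤-trans (p⊆q⇒∣p∣≤∣q∣ (x∉p⇒x∈∁p ∘ P∩S)) fuel)) (<-irrefl refl)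
    grow (suc k) P m z c∈P P∩S m<P near fuel | yes (w , w∉S , w∉P)
      with exit P∩S (proj₂ (conn c w)) c∈P w∉P w∉S
    ... | x , y , x∈P , y∉P , y∉S , xy with recentre near x∈P xy
    ... | z′ , near′ = grow k (P ∪ ⁅ y ⁆) (suc m) z′ (p⊆p∪q ⁅ y ⁆ c∈P) avoids
      (≤-trans (s≤s m<P) (∣p∣<∣p∪⁅x⁆∣ y∉P)) near′ (subst (∣ ∁ S ∣ ≤_) (≡.sym (+-suc k m)) fuel)
      where
      avoids : ∀ {v} → v ∈ P ∪ ⁅ y ⁆ → v ∉ S
      avoids {v} v∈ with x∈p∪q⁻ P ⁅ y ⁆ v∈
      ... | inj₁ v∈P = P∩S v∈P
      ... | inj₂ v∈y = subst (_∉ S) (≡.sym (x∈⁅y⁆⇒x≡y y v∈y)) y∉S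

  radius≤∣∁S∣ : ∀ {r} → 1 ≤ r → Radius G r → r ≤ ∣ ∁ S ∣
  -- The inequality is decidable, hence stable, so a distance function under double negation is
  -- enough.
  radius≤∣∁S∣ {r} 1≤r rad@((v , _ , u , far) , _) = decidable-stable (r ≤? ∣ ∁ S ∣)
    (¬¬-map (λ D → DistanceProperties.radius≤ D rad z near) (¬¬-distance conn))
    where
    -- As `r` is positive, some walk has an edge, and one end of that edge lies outside `S`.
    escape : ∃ (_∉ S)
    escape with conn v u
    ... | k , here = contradiction (≤-trans 1≤r (far 0 here)) λ ()
    ... | k , step {v = w} e _ with v ∈? S
    ...   | yes v∈S = w , λ w∈S → ind v w v∈S w∈S e
    ...   | no v∉S = v , v∉S

    c = proj₁ escape
    centre = ∁-centre (proj₂ escape)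
    m = proj₁ centre
    z = proj₁ (proj₂ centre)
    m<∁S = proj₁ (proj₂ (proj₂ centre))
    near-∁S = proj₂ (proj₂ (proj₂ centre))

    near : ∀ w → Near G ∣ ∁ S ∣ z w
    near w with w ∈? S | conn w c
    ... | no w∉S | _ = Near-mono (<⇒≤ m<∁S) (near-∁S w∉S)
    ... | yes w∈S | _ , here = contradiction w∈S (proj₂ escape)
    -- The neighbours of a vertex of `S` lie in `∁ S`, so one extra step suffices, and `m < ∣ ∁ S ∣`
    -- pays for it.
    ... | yes w∈S | _ , step {v = w′} e _ with near-∁S (λ w′∈S → ind w w′ w∈S w′∈S e)
    ...   | k , k≤m , p = suc k , ≤-trans (s≤s k≤m) m<∁S , snoc p (sym G e)

independent-≤ : ∀ {n r} {G : Graph n} → Connected G → 1 ≤ r → Radius G r →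
                ∀ S → Independent G S → ∣ S ∣ ≤ n ∸ r
independent-≤ {n} {r} {G} conn 1≤r rad S ind = begin
  ∣ S ∣           ≡⟨ m∸[m∸n]≡n (∣p∣≤n S) ⟨
  n ∸ (n ∸ ∣ S ∣) ≡⟨ cong (n ∸_) (∣∁p∣≡n∸∣p∣ S) ⟨
  n ∸ ∣ ∁ S ∣     ≤⟨ ∸-monoʳ-≤ n (radius≤∣∁S∣ conn ind 1≤r rad) ⟩
  n ∸ r           ∎
  where open ≤-Reasoning

-- The order of an almost self-centered graph

record Poles {n : ℕ} {G : Graph n} (D : Distance G) (r : ℕ) : Set where
  open Distance D
  field
    x y     : Fin n
    dxy     : d x y ≡ suc r
    central : ∀ v → v ≢ x → v ≢ y → Ecc G v r

two-outside : ∀ {n} (S : Subset n) → 2 ≤ n → ∣ S ∣ ≡ n ∸ 2 →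
              ∃ (_∉ S) × (∀ {x y z} → x ∉ S → y ∉ S → z ∉ S → y ≢ x → z ≢ x → z ≢ y → ⊥)
two-outside {n} S 2≤n ∣S∣≡ = nonempty , no-third
  where
  ∣∁S∣≡2 : ∣ ∁ S ∣ ≡ 2
  ∣∁S∣≡2 = ≡.trans (∣∁p∣≡n∸∣p∣ S) (≡.trans (cong (n ∸_) ∣S∣≡) (m∸[m∸n]≡n 2≤n))

  nonempty : ∃ (_∉ S)
  nonempty with nonempty? (∁ S)
  ... | yes (x , x∈∁S) = x , x∈∁p⇒x∉p x∈∁S
  ... | no empty = contradiction
    (≡.trans (≡.sym ∣∁S∣≡2) (≡.trans (cong ∣_∣ (Empty-unique empty)) (∣⊥∣≡0 n))) λ ()

  no-third : ∀ {x y z} → x ∉ S → y ∉ S → z ∉ S → y ≢ x → z ≢ x → z ≢ y → ⊥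
  -- Deleting three distinct elements would lower the cardinality 2 of `∁ S` three times.
  no-third {x} {y} {z} x∉S y∉S z∉S y≢x z≢x z≢y = 1+n≰n (subst (3 ≤_) ∣∁S∣≡2
    (≤-trans (s≤s (≤-trans (s≤s (≤-trans (s≤s z≤n)
      (x∈p⇒∣p-x∣<∣p∣ z∈))) (x∈p⇒∣p-x∣<∣p∣ y∈))) (x∈p⇒∣p-x∣<∣p∣ (x∉p⇒x∈∁p x∉S))))
    where
    y∈ : y ∈ ∁ S ∖ x
    y∈ = x∈p∧x≢y⇒x∈p-y (x∉p⇒x∈∁p y∉S) y≢x
    z∈ : z ∈ ∁ S ∖ x ∖ y
    z∈ = x∈p∧x≢y⇒x∈p-y (x∈p∧x≢y⇒x∈p-y (x∉p⇒x∈∁p z∉S) z≢x) z≢y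

radius≥2⇒order≥2 : ∀ {n r} {G : Graph n} → 2 ≤ r → Radius G r → 2 ≤ n
radius≥2⇒order≥2 {zero} _ ((() , _) , _)
radius≥2⇒order≥2 {suc zero} 2≤r ((zero , _ , zero , far) , _) =
  contradiction (≤-trans 2≤r (far 0 here)) λ ()
radius≥2⇒order≥2 {suc (suc n)} _ _ = s≤s (s≤s z≤n)

-- Take `x` outside `S` and `y` farthest from `x`. The distance exceeds `r`, so `y` is not central
-- either, and all other vertices are.
poles : ∀ {n r} {G : Graph n} (D : Distance G) → 2 ≤ r → AlmostSelfCentered G → Radius G r → Poles D r
poles {n} {r} {G} D 2≤r (_ , S , ∣S∣≡ , S⇔) rad = record
  { x = x ; y = y ; dxy = ≤-antisym d≤ d≥ ; central = central }
  where
  open DistanceProperties D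
  ecc-in : ∀ {v} → v ∈ S → Ecc G v r
  ecc-in {v} v∈S = Equivalence.to (S⇔ v) v∈S r rad

  ecc-out : ∀ {v e} → v ∉ S → Ecc G v e → r < e
  ecc-out {v} v∉S ev = ≤∧≢⇒< (proj₂ rad v _ ev) λ { refl →
    v∉S (Equivalence.from (S⇔ v) λ s rad′ → subst (Ecc G v) (Radius-unique rad rad′) ev) }

  out = two-outside S (radius≥2⇒order≥2 2≤r rad) ∣S∣≡
  x = proj₁ (proj₁ out)
  x∉S = proj₂ (proj₁ out)
  ecc-x = eccentricity x
  far-x = eccentricity-attained (proj₂ ecc-x)
  y = proj₁ far-x

  d≥ : suc r ≤ d x y
  d≥ = subst (suc r ≤_) (≡.sym (proj₂ far-x)) (ecc-out x∉S (proj₂ ecc-x))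

  y≢x : y ≢ x
  y≢x y≡x = d>0⇒≢ (≤-trans (s≤s z≤n) d≥) (≡.sym y≡x)

  y∉S : y ∉ S
  y∉S y∈S = <⇒≱ d≥ (subst (_≤ r) (d-sym y x) (eccentricity-≤ (ecc-in y∈S) x))

  central : ∀ v → v ≢ x → v ≢ y → Ecc G v r
  central v v≢x v≢y = ecc-in (decidable-stable (v ∈? S) λ v∉S →
    proj₂ out x∉S y∉S v∉S y≢x v≢x v≢y)

  -- The vertex after `x` is central, hence within `r` of `y`. The end `v` is a variable because `y`
  -- is a projection and cannot be matched.
  first-step : ∀ {v k} → v ≡ y → Walk G x v k → d x y ≤ suc r
  first-step x≡y here = contradiction (≡.sym x≡y) y≢x
  first-step refl (step {v = w} e p) = ≤-trans (d-triangle x w y)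
    (+-mono-≤ (least (step e here)) (eccentricity-≤ (central w w≢x w≢y) y))
    where
    w≢x : w ≢ x
    w≢x w≡x = irrefl G (subst (Adj G x) w≡x e)
    w≢y : w ≢ y
    w≢y w≡y = <⇒≱ d≥ (≤-trans (least (step (subst (Adj G x) w≡y e) here)) (≤-trans (n≤1+n 1) 2≤r))

  d≤ : d x y ≤ suc r
  d≤ = first-step refl (walk x y)

-- Counting vertices layer by layer

module Layers {n : ℕ} (f : Fin n → ℕ) where

  -- The count is carried by an explicit set below level `k`, so vertices at level `k` are certain
  -- to be new.
  Packed : ℕ → ℕ → Set
  Packed k m = Σ (Subset n) λ P → m ≤ ∣ P ∣ × (∀ {v} → v ∈ P → f v < k)

  Thick : ℕ → Set
  Thick k = ∃ λ a → ∃ λ b → f a ≡ k × f b ≡ k × b ≢ a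

  packed-empty : Packed 0 0
  packed-empty = ∅ , z≤n , λ v∈⊥ → contradiction v∈⊥ ∉⊥

  insert : ∀ (P : Subset n) {a k m} → f a ≡ k → a ∉ P → m ≤ ∣ P ∣ → (∀ {v} → v ∈ P → f v < suc k) →
           Packed (suc k) (suc m)
  insert P {a} fa≡k a∉P m≤ P<k = P ∪ ⁅ a ⁆ , ≤-trans (s≤s m≤) (∣p∣<∣p∪⁅x⁆∣ a∉P) , below
    where
    below : ∀ {v} → v ∈ P ∪ ⁅ a ⁆ → f v < suc _
    below v∈ with x∈p∪q⁻ P ⁅ a ⁆ v∈
    ... | inj₁ v∈P = P<k v∈P
    ... | inj₂ v∈a with x∈⁅y⁆⇒x≡y a v∈a
    ... | refl = s≤s (≤-reflexive fa≡k)

  one : ∀ {k m a} → f a ≡ k → Packed k m → Packed (suc k) (suc m)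
  one fa≡k (P , m≤ , P<k) = insert P fa≡k (λ a∈P → <⇒≢ (P<k a∈P) fa≡k) m≤ (m≤n⇒m≤1+n ∘ P<k)

  two : ∀ {k m} → Thick k → Packed k m → Packed (suc k) (suc (suc m))
  two {k} {m} (a , b , fa≡k , fb≡k , b≢a) (P , m≤ , P<k) =
    insert (P ∪ ⁅ a ⁆) fb≡k b∉ (≤-trans (s≤s m≤) (∣p∣<∣p∪⁅x⁆∣ a∉P)) (proj₂ (proj₂ with-a))
    where
    a∉P : a ∉ P
    a∉P a∈P = <⇒≢ (P<k a∈P) fa≡k
    with-a : Packed (suc k) (suc m)
    with-a = insert P fa≡k a∉P m≤ (m≤n⇒m≤1+n ∘ P<k)
    b∉ : b ∉ P ∪ ⁅ a ⁆
    b∉ b∈ with x∈p∪q⁻ P ⁅ a ⁆ b∈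
    ... | inj₁ b∈P = <⇒≢ (P<k b∈P) fb≡k
    ... | inj₂ b∈a = b≢a (x∈⁅y⁆⇒x≡y a b∈a)

  order : ∀ {k m} → Packed k m → m ≤ n
  order (P , m≤ , _) = ≤-trans m≤ (∣p∣≤n P)

module PoleLayers {n r : ℕ} {G : Graph n} {D : Distance G} (poles : Poles D r) (2≤r : 2 ≤ r) where
  open DistanceProperties D
  open Poles poles
  open Layers (d x)

  -- A shortest walk from `x` to `y` meets every level, and its remainder has the stated length.
  layer : ∀ i → i ≤ suc r → ∃ λ a → d x a ≡ i × d a y ≤ suc r ∸ i
  layer i i≤ with crossing x i x y (≤-trans (≤-reflexive (d-refl x)) z≤n) (subst (i ≤_) (≡.sym dxy) i≤)
  ... | a , refl , da≤ = a , refl ,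
    subst (_≤ suc r ∸ d x a) (m+n∸m≡n (d x a) (d a y)) (∸-monoˡ-≤ (d x a) (subst (d x a + d a y ≤_) dxy da≤))

  inner : ∀ {a i} → d x a ≡ i → 1 ≤ i → i ≤ r → Ecc G a r
  inner {a} refl 1≤i i≤r = central a
    (λ { refl → d>0⇒≢ 1≤i refl })
    (λ { refl → 1+n≰n (subst (_≤ r) dxy i≤r) })

  -- A central end keeps the distance within `r`; otherwise both ends are poles.
  d-bound : ∀ u v → d u v ≤ suc r
  d-bound u v with u Fin.≟ x | u Fin.≟ y | v Fin.≟ x | v Fin.≟ y
  ... | no u≢x | no u≢y | _ | _ = m≤n⇒m≤1+n (eccentricity-≤ (central u u≢x u≢y) v)
  ... | _ | _ | no v≢x | no v≢y =
    subst (_≤ suc r) (d-sym v u) (m≤n⇒m≤1+n (eccentricity-≤ (central v v≢x v≢y) u))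
  ... | yes refl | _ | yes refl | _ = ≤-trans (least here) z≤n
  ... | yes refl | _ | _ | yes refl = ≤-reflexive dxy
  ... | _ | yes refl | yes refl | _ = ≤-reflexive (≡.trans (d-sym y x) dxy)
  ... | _ | yes refl | _ | yes refl = ≤-trans (least here) z≤n

  dx>r⇒y : ∀ {u} → r < d x u → u ≡ y
  dx>r⇒y {u} r<d = decidable-stable (u Fin.≟ y) λ u≢y →
    <⇒≱ r<d (subst (_≤ r) (d-sym u x) (eccentricity-≤ (central u u≢x u≢y) x))
    where
    u≢x : u ≢ x
    u≢x refl = d>0⇒≢ (≤-trans (s≤s z≤n) r<d) refl

  Thin : ℕ → Fin n → Set
  Thin i a = ∀ w → d x w ≡ i → w ≡ a

  thick∨thin : ∀ {a i} → d x a ≡ i → Thick i ⊎ Thin i a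
  thick∨thin {a} {i} da≡i with Fin.any? (λ w → (d x w ≟ i) ×-dec ¬? (w Fin.≟ a))
  ... | yes (w , dw≡i , w≢a) = inj₁ (a , w , da≡i , dw≡i , w≢a)
  ... | no none = inj₂ λ w dw≡i → decidable-stable (w Fin.≟ a) λ w≢a → none (w , dw≡i , w≢a)

  -- A shortest walk across a thin layer must use its only vertex.
  through : ∀ {a i} → Thin i a → ∀ u v → d x u ≤ i → i ≤ d x v → d u a + d a v ≤ d u v
  through {a} {i} thin u v du≤i i≤dv with crossing x i u v du≤i i≤dv
  ... | w , dw≡i , dw≤ with thin w dw≡i
  ... | refl = dw≤

  -- The single vertex a of a thin layer separates; a vertex at distance r from a would be too far
  -- from x or from y.
  middle-thick : ∀ {i} → 2 ≤ i → i < r → Thick i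
  middle-thick {i} 2≤i i<r with layer i (m≤n⇒m≤1+n (<⇒≤ i<r))
  ... | a , da≡i , _ with thick∨thin da≡i
  ... | inj₁ thick = thick
  ... | inj₂ thin with eccentricity-attained (inner da≡i (≤-trans (n≤1+n 1) 2≤i) (<⇒≤ i<r))
  ... | z , daz≡r with ≤-total i (d x z)
  ... | inj₁ i≤dz = contradiction
    (begin
      2 + r         ≤⟨ +-monoˡ-≤ r 2≤i ⟩
      i + r         ≡⟨ ≡.cong₂ _+_ da≡i daz≡r ⟨
      d x a + d a z ≤⟨ through thin x z (≤-trans (least here) z≤n) i≤dz ⟩
      d x z         ≤⟨ d-bound x z ⟩
      suc r         ∎) 1+n≰n
    where open ≤-Reasoning
  -- The mirror case: every walk from `z` to `y` crosses `a`, and `i < r` leaves `a` at distance at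
  -- least 2 from `y`.
  ... | inj₂ dz≤i = contradiction
    (begin
      2 + r                 ≤⟨ +-monoˡ-≤ r 2≤day ⟩
      d a y + r             ≡⟨ +-comm (d a y) r ⟩
      r + d a y             ≡⟨ cong (_+ d a y) daz≡r ⟨
      d a z + d a y         ≡⟨ cong (_+ d a y) (d-sym a z) ⟩
      d z a + d a y         ≤⟨ through thin z y dz≤i (subst (i ≤_) (≡.sym dxy) (m≤n⇒m≤1+n (<⇒≤ i<r))) ⟩
      d z y                 ≤⟨ d-bound z y ⟩
      suc r                 ∎) 1+n≰n
    where
    open ≤-Reasoning
    2≤day : 2 ≤ d a y
    2≤day = +-cancelˡ-≤ i 2 (d a y) (begin
      i + 2         ≡⟨ +-comm i 2 ⟩
      suc (suc i)   ≤⟨ s≤s i<r ⟩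
      suc r         ≡⟨ dxy ⟨
      d x y         ≤⟨ d-triangle x a y ⟩
      d x a + d a y ≡⟨ cong (_+ d a y) da≡i ⟩
      i + d a y     ∎)

  -- `base` counts the layers 0 and 1; the layers 2 to `j + 1` add two vertices each.
  middle : ∀ j {m} → 2 + j ≤ r → Packed 2 m → Packed (2 + j) (j * 2 + m)
  middle zero    _    base = base
  middle (suc j) 2+j< base =
    two (middle-thick (s≤s (s≤s z≤n)) 2+j<) (middle j (<⇒≤ 2+j<) base)

  -- If both layers next to the poles were thin, the second vertex of a geodesic from x to y would
  -- have eccentricity less than r.
  end-thick : 3 ≤ r → Thick 1 ⊎ Thick r
  end-thick 3≤r with layer 1 (s≤s z≤n) | layer r (n≤1+n r) | layer 2 (≤-trans 2≤r (n≤1+n r))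
  ... | a , da , _ | b , db , _ | c , dc , dcy with thick∨thin da | thick∨thin db
  ... | inj₁ thick | _ = inj₁ thick
  ... | _ | inj₁ thick = inj₂ thick
  ... | inj₂ thin-a | inj₂ thin-b with eccentricity-attained (inner dc (s≤s z≤n) 2≤r)
  ... | u , dcu≡r = ⊥-elim (absurd (m≤n⇒m<n∨m≡n r≤dxu))
    where
    open ≤-Reasoning
    u≢x : u ≢ x
    u≢x refl = 1+n≰n (begin
      3     ≤⟨ 3≤r ⟩
      r     ≡⟨ dcu≡r ⟨
      d c x ≡⟨ d-sym c x ⟩
      d x c ≡⟨ dc ⟩
      2     ∎)

    dxu≥1 : 1 ≤ d x u
    dxu≥1 with d x u | walk x u
    ... | zero  | here = contradiction refl u≢x
    ... | suc _ | _    = s≤s z≤n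

    via-a : ∀ {v} → 1 ≤ d x v → suc (d a v) ≤ d x v
    via-a {v} 1≤ = subst (λ l → l + d a v ≤ d x v) da (through thin-a x v (≤-trans (least here) z≤n) 1≤)

    dac≤1 : d a c ≤ 1
    dac≤1 = ≤-pred (subst (suc (d a c) ≤_) dc (via-a (subst (1 ≤_) (≡.sym dc) (s≤s z≤n))))

    -- Layer 1 is thin, so `a` is adjacent to `c` and precedes `u` on a shortest walk from `x`.
    -- Hence `u` lies at level `r` or beyond.
    r≤dxu : r ≤ d x u
    r≤dxu = begin
      r             ≡⟨ dcu≡r ⟨
      d c u         ≤⟨ d-triangle c a u ⟩
      d c a + d a u ≤⟨ +-monoˡ-≤ (d a u) (subst (_≤ 1) (d-sym a c) dac≤1) ⟩
      suc (d a u)   ≤⟨ via-a dxu≥1 ⟩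
      d x u         ∎

    dcy<r : d c y < r
    dcy<r = ≤-trans (s≤s dcy) (≤-reflexive (m+[n∸m]≡n (≤-trans (n≤1+n 1) 2≤r)))

    -- Layer `r` is thin, so `b` lies on a shortest walk from `c` to `y`. Thus neither candidate for
    -- `u`, `b` or `y`, is far enough from `c`.
    dcb<r : d c b < r
    dcb<r = ≤-trans (s≤s (≤-trans (m≤m+n (d c b) (d b y))
      (through thin-b c y (subst (_≤ r) (≡.sym dc) 2≤r) (subst (r ≤_) (≡.sym dxy) (n≤1+n r))))) dcy<r

    absurd : r < d x u ⊎ r ≡ d x u → ⊥
    absurd (inj₁ r<dxu) with dx>r⇒y r<dxu
    ... | refl = <⇒≢ dcy<r dcu≡r
    absurd (inj₂ r≡dxu) with thin-b u (≡.sym r≡dxu)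
    ... | refl = <⇒≢ dcb<r dcu≡r

  add-layer : ∀ {k m} → k ≤ suc r → Packed k m → Packed (suc k) (suc m)
  add-layer k≤ = one (proj₁ (proj₂ (layer _ k≤)))

  -- One vertex from each of the layers 0 to `r + 1`. For `r` = 2 this yields order at least 4.
  radius+2≤order : 2 + r ≤ n
  radius+2≤order = order (geodesic (2 + r) ≤-refl)
    where
    geodesic : ∀ k → k ≤ 2 + r → Packed k k
    geodesic zero    _  = packed-empty
    geodesic (suc k) k< = add-layer (≤-pred k<) (geodesic k (≤-trans (n≤1+n k) k<))

  2radius<order : 3 ≤ r → r * 2 < n
  2radius<order 3≤r with end-thick 3≤r | m≤n⇒∃[o]m+o≡n 2≤r
  -- With `r` written as `2 + j`: one vertex in layer 0, two in layer 1, `j * 2` in the layers 2 to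
  -- `r ∸ 1`, and one each in `r` and `r + 1`.
  ... | inj₁ thick | j , refl = subst (_≤ n) (cong (2 +_) (+-comm (j * 2) 3))
    (order (add-layer ≤-refl (add-layer (n≤1+n _)
      (middle j ≤-refl (two thick (add-layer z≤n packed-empty))))))
  ... | inj₂ thick | j , refl = subst (_≤ n) (cong (3 +_) (+-comm (j * 2) 2))
    (order (add-layer ≤-refl (two thick
      (middle j ≤-refl (add-layer (s≤s z≤n) (add-layer z≤n packed-empty))))))

-- Extremal graphs

module _ {n : ℕ} {G : Graph n} where

  -- The increments of `f` add up along the walk; a suitable `f` thus certifies lower bounds on
  -- distances.
  lipschitz : (f : Fin n → ℕ) → (∀ {u v} → Adj G u v → f v ≤ suc (f u)) →
              ∀ {u v k} → Walk G u v k → f v ≤ k + f u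
  lipschitz f lip here = ≤-refl
  lipschitz f lip {u} {v} (step {v = w} {k = k} e p) = begin
    f v           ≤⟨ lipschitz f lip p ⟩
    k + f w       ≤⟨ +-monoʳ-≤ k (lip e) ⟩
    k + suc (f u) ≡⟨ +-suc k (f u) ⟩
    suc k + f u   ∎
    where open ≤-Reasoning

  -- The eccentricities of `x` and `y` exceed `r` and all others equal `r`, so the central vertices
  -- form the complement of a pair. The vertex `c` witnesses the radius and connects the graph.
  almostSelfCentered : ∀ {r x y} → (∃ λ c → c ≢ x × c ≢ y) →
    (∀ {v} → v ≢ x → v ≢ y → (∀ u → Near G r v u) × ∃ (Far G r v)) →
    Far G (suc r) x y → AlmostSelfCentered G × Radius G r
  almostSelfCentered {r} {x} {y} (c , c≢x , c≢y) ecc far =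
    (connected , S , ∣S∣≡ , λ v → mk⇔ to (from v)) , radius
    where
    connected : Connected G
    connected u v with proj₁ (ecc c≢x c≢y) u | proj₁ (ecc c≢x c≢y) v
    ... | j , _ , p | k , _ , q = j + k , reverse p ++ q

    radius : Radius G r
    radius = (c , ecc c≢x c≢y) , least
      where
      least : ∀ v e → Ecc G v e → r ≤ e
      least v e (near , _) with v Fin.≟ x | v Fin.≟ y
      ... | yes refl | _ with near y
      ...   | k , k≤e , p = ≤-trans (n≤1+n r) (≤-trans (far k p) k≤e)
      least v e (near , _) | _ | yes refl with near x
      ...   | k , k≤e , p = ≤-trans (n≤1+n r) (≤-trans (far k (reverse p)) k≤e)
      least v e (near , _) | no v≢x | no v≢y with proj₂ (ecc v≢x v≢y)
      ...   | u , far-u with near u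
      ...     | k , k≤e , p = ≤-trans (far-u k p) k≤e

    pair S : Subset n
    pair = ⁅ x ⁆ ∪ ⁅ y ⁆
    S = ∁ pair

    ∣pair∣≡2 : ∣ pair ∣ ≡ 2
    ∣pair∣≡2 = ≤-antisym
      (subst (λ l → ∣ pair ∣ ≤ suc l) (∣⁅x⁆∣≡1 x) (∣p∪⁅x⁆∣≤1+∣p∣ ⁅ x ⁆ y))
      (subst (_< ∣ pair ∣) (∣⁅x⁆∣≡1 x) (∣p∣<∣p∪⁅x⁆∣ y∉⁅x⁆))
      where
      y∉⁅x⁆ : y ∉ ⁅ x ⁆
      y∉⁅x⁆ y∈ with x∈⁅y⁆⇒x≡y x y∈
      ... | refl = contradiction (far 0 here) λ ()

    ∣S∣≡ : ∣ S ∣ ≡ n ∸ 2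
    ∣S∣≡ = ≡.trans (∣∁p∣≡n∸∣p∣ pair) (cong (n ∸_) ∣pair∣≡2)

    to : ∀ {v} → v ∈ S → Central G v
    to {v} v∈S s rad = subst (Ecc G v) (Radius-unique radius rad) (ecc
      (λ { refl → x∈∁p⇒x∉p v∈S (p⊆p∪q ⁅ y ⁆ (x∈⁅x⁆ x)) })
      (λ { refl → x∈∁p⇒x∉p v∈S (q⊆p∪q ⁅ x ⁆ ⁅ y ⁆ (x∈⁅x⁆ y)) }))

    from : ∀ v → Central G v → v ∈ S
    from v central = x∉p⇒x∈∁p λ v∈ → case (x∈p∪q⁻ ⁅ x ⁆ ⁅ y ⁆ v∈) (central r radius)
      where
      case : v ∈ ⁅ x ⁆ ⊎ v ∈ ⁅ y ⁆ → Ecc G v r → ⊥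
      case (inj₁ v∈) (near , _) with x∈⁅y⁆⇒x≡y x v∈ | near y
      ... | refl | k , k≤r , p = 1+n≰n (≤-trans (far k p) k≤r)
      case (inj₂ v∈) (near , _) with x∈⁅y⁆⇒x≡y y v∈ | near x
      ... | refl | k , k≤r , p = 1+n≰n (≤-trans (far k (reverse p)) k≤r)

Extremal : ℕ → ℕ → Set₁
Extremal n r = Σ (Graph n) λ G → AlmostSelfCentered G × Radius G r × IndepNum G (n ∸ r)

-- One independent set of size `n ∸ r` is enough, because `independent-≤` gives the matching upper
-- bound.
extremal : ∀ {n r} (G : Graph n) → 1 ≤ r → AlmostSelfCentered G × Radius G r →
           (Σ (Subset n) λ S → Independent G S × ∣ S ∣ ≡ n ∸ r) → Extremal n r
extremal G 1≤r (asc , rad) S = G , asc , rad , S , independent-≤ (proj₁ asc) 1≤r rad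

-- The path on four vertices

module P₄ where

  data Link : Fin 4 → Fin 4 → Set where
    link : ∀ i → Link (inject₁ i) (suc i)

  P₄ : Graph 4
  P₄ = record
    { Adj    = λ u v → Link u v ⊎ Link v u
    ; sym    = swap
    ; irrefl = λ { (inj₁ e) → no-loop e ; (inj₂ e) → no-loop e }
    }
    where
    no-loop : ∀ {v} → ¬ Link v v
    no-loop e = 1+n≢n (≡.sym (toℕ-link e refl))
      where
      toℕ-link : ∀ {u v} → Link u v → u ≡ v → toℕ u ≡ suc (toℕ u)
      toℕ-link (link i) eq = ≡.trans (cong toℕ eq) (cong suc (≡.sym (Fin.toℕ-inject₁ i)))

  toℕ-lipschitz : ∀ {u v} → Adj P₄ u v → toℕ v ≤ suc (toℕ u)
  toℕ-lipschitz (inj₁ (link i)) = s≤s (≤-reflexive (≡.sym (Fin.toℕ-inject₁ i)))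
  toℕ-lipschitz (inj₂ (link i)) = ≤-trans (≤-reflexive (Fin.toℕ-inject₁ i)) (≤-trans (n≤1+n _) (n≤1+n _))

  far : ∀ {u v m} → m + toℕ u ≤ toℕ v → Far P₄ m u v
  far {u} {v} {m} m+u≤v k p =
    +-cancelʳ-≤ (toℕ u) m k (≤-trans m+u≤v (lipschitz toℕ toℕ-lipschitz p))

  far-sym : ∀ {u v m} → Far P₄ m u v → Far P₄ m v u
  far-sym far k p = far k (reverse p)

  pattern 0F = zero
  pattern 1F = suc zero
  pattern 2F = suc (suc zero)
  pattern 3F = suc (suc (suc zero))

  up : ∀ i → Walk P₄ (inject₁ i) (suc i) 1
  up i = step (inj₁ (link i)) here

  down : ∀ i → Walk P₄ (suc i) (inject₁ i) 1
  down i = reverse (up i)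

  near₁ : ∀ u → Near P₄ 2 1F u
  near₁ 0F = 1 , s≤s z≤n , down 0F
  near₁ 1F = 0 , z≤n , here
  near₁ 2F = 1 , s≤s z≤n , up 1F
  near₁ 3F = 2 , ≤-refl , up 1F ++ up 2F

  near₂ : ∀ u → Near P₄ 2 2F u
  near₂ 0F = 2 , ≤-refl , down 1F ++ down 0F
  near₂ 1F = 1 , s≤s z≤n , down 1F
  near₂ 2F = 0 , z≤n , here
  near₂ 3F = 1 , s≤s z≤n , up 2F

  inner : ∀ {v} → v ≢ 0F → v ≢ 3F → (∀ u → Near P₄ 2 v u) × ∃ (Far P₄ 2 v)
  inner {0F} v≢0 _ = contradiction refl v≢0
  inner {1F} _ _ = near₁ , 3F , far ≤-refl
  inner {2F} _ _ = near₂ , 0F , far-sym (far ≤-refl)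
  inner {3F} _ v≢3 = contradiction refl v≢3

  S : Subset 4
  S = inside ∷ outside ∷ inside ∷ outside ∷ []

  link-leaves-S : ∀ {u v} → Link u v → u ∈ S → v ∈ S → ⊥
  link-leaves-S (link 0F) _ (there ())
  link-leaves-S (link 1F) (there ()) _
  link-leaves-S (link 2F) _ (there (there (there ())))

  S-independent : Independent P₄ S
  S-independent u v u∈S v∈S (inj₁ e) = link-leaves-S e u∈S v∈S
  S-independent u v u∈S v∈S (inj₂ e) = link-leaves-S e v∈S u∈S

  P₄-extremal : Extremal 4 2
  P₄-extremal = extremal P₄ (s≤s z≤n)
    (almostSelfCentered (1F , (λ ()) , λ ()) inner (far ≤-refl)) (S , S-independent , refl)

-- The even cycle with a pendant vertex and twins

oddOrBeyond : ∀ r m → Subset (r * 2 + m)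
oddOrBeyond zero    m = ⊤
oddOrBeyond (suc r) m = outside ∷ inside ∷ oddOrBeyond r m

∣oddOrBeyond∣ : ∀ r m → ∣ oddOrBeyond r m ∣ ≡ r + m
∣oddOrBeyond∣ zero    m = ∣⊤∣≡n m
∣oddOrBeyond∣ (suc r) m = cong suc (∣oddOrBeyond∣ r m)

-- Consecutive positions differ in parity. The bound on `v` excludes the step from the last odd
-- position to `r * 2`, both of which belong to the set.
oddOrBeyond-next : ∀ r {m} {u v : Fin (r * 2 + m)} → toℕ v ≡ suc (toℕ u) → toℕ v < r * 2 →
                   u ∈ oddOrBeyond r m → v ∉ oddOrBeyond r m
oddOrBeyond-next zero _ ()
oddOrBeyond-next (suc _) {u = zero} _ _ ()
oddOrBeyond-next (suc (suc _)) {u = suc zero} {suc (suc zero)} _ _ _ (there (there ()))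
oddOrBeyond-next (suc zero) {u = suc zero} {suc (suc _)} _ (s≤s (s≤s ()))
oddOrBeyond-next (suc r) {u = suc (suc _)} {suc (suc _)} v≡ v< (there (there u∈)) (there (there v∈)) =
  oddOrBeyond-next r (suc-injective (suc-injective v≡)) (≤-pred (≤-pred v<)) u∈ v∈

module Cycle (r m : ℕ) (2≤r : 2 ≤ r) where

  -- `R` cycle vertices, one pendant vertex and `m` twins.
  R n : ℕ
  R = r * 2
  n = R + suc m

  -- A cycle on the vertices below R = 2r, a pendant vertex R attached to 0, and twins of the
  -- vertex 1 beyond it.
  data Link : ℕ → ℕ → Set where
    next : ∀ {k} → suc k < R → Link k (suc k)
    hub  : ∀ {k} → R ≤ suc k → Link 0 k
    twin : ∀ {k} → R < k → Link 2 k

  R≡r+r : R ≡ r + r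
  R≡r+r = ≡.trans (*-comm r 2) (cong (r +_) (+-identityʳ r))

  4≤R : 4 ≤ R
  4≤R = *-monoˡ-≤ 2 2≤r

  0<R : 0 < R
  0<R = ≤-trans (s≤s z≤n) 4≤R

  1<R : 1 < R
  1<R = ≤-trans (s≤s (s≤s z≤n)) 4≤R

  r<R : r < R
  r<R = subst (r <_) (≡.sym R≡r+r) (m<m+n r (≤-trans (s≤s z≤n) 2≤r))

  no-loop : ∀ {k l} → Link k l → k ≢ l
  no-loop (next _)    eq   = 1+n≢n (≡.sym eq)
  no-loop (hub R≤1)  refl = contradiction (≤-trans 4≤R R≤1) λ { (s≤s ()) }
  no-loop (twin R<2) refl = contradiction (≤-trans 4≤R (<⇒≤ R<2)) λ { (s≤s (s≤s ())) }

  G : Graph n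
  G = record
    { Adj    = λ u v → Link (toℕ u) (toℕ v) ⊎ Link (toℕ v) (toℕ u)
    ; sym    = swap
    ; irrefl = λ { (inj₁ e) → no-loop e refl ; (inj₂ e) → no-loop e refl }
    }

  -- Lower bounds on distances

  Close : ℕ → ℕ → Set
  Close a b = a ≤ suc b × b ≤ suc a

  -- The distance on a cycle of length `R` between labels that differ by `t`.
  arc : ℕ → ℕ
  arc t = t ⊓ (R ∸ t)

  arc-close : ∀ {a b} → Close a b → Close (arc a) (arc b)
  arc-close (a≤ , b≤) = half a≤ b≤ , half b≤ a≤
    where
    half : ∀ {a b} → a ≤ suc b → b ≤ suc a → arc a ≤ suc (arc b)
    half {a} {b} a≤ b≤ = ⊓-mono-≤ a≤ (begin
      R ∸ a           ≤⟨ m≤n+m∸n (R ∸ a) 1 ⟩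
      suc (R ∸ a ∸ 1) ≡⟨ cong suc (∸-+-assoc R a 1) ⟩
      suc (R ∸ (a + 1)) ≡⟨ cong (λ l → suc (R ∸ l)) (+-comm a 1) ⟩
      suc (R ∸ suc a) ≤⟨ s≤s (∸-monoʳ-≤ R b≤) ⟩
      suc (R ∸ b)     ∎)
      where open ≤-Reasoning

  ∣-∣-close : ∀ i k → Close ∣ i - k ∣ ∣ i - suc k ∣
  ∣-∣-close zero    k       = m≤n⇒m≤1+n (n≤1+n k) , ≤-refl
  ∣-∣-close (suc i) zero    rewrite ∣-∣-identityʳ i = ≤-refl , m≤n⇒m≤1+n (n≤1+n i)
  ∣-∣-close (suc i) (suc k) = ∣-∣-close i k

  -- The distance from a cycle vertex i, except that a twin gets the value of 1; being 1-Lipschitz, it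
  -- bounds walks from below.
  dist : ℕ → ℕ → ℕ
  dist i j with <-cmp j R
  ... | tri< _ _ _ = arc ∣ i - j ∣
  ... | tri≈ _ _ _ = suc (arc i)
  ... | tri> _ _ _ = arc ∣ i - 1 ∣

  dist-< : ∀ i {j} → j < R → dist i j ≡ arc ∣ i - j ∣
  dist-< i {j} j<R with <-cmp j R
  ... | tri< _ _ _ = refl
  ... | tri≈ j≮R _ _ = contradiction j<R j≮R
  ... | tri> j≮R _ _ = contradiction j<R j≮R

  dist-R : ∀ i → dist i R ≡ suc (arc i)
  dist-R i with <-cmp R R
  ... | tri< _ R≢R _ = contradiction refl R≢R
  ... | tri≈ _ _ _ = refl
  ... | tri> _ R≢R _ = contradiction refl R≢R

  dist-> : ∀ i {j} → R < j → dist i j ≡ arc ∣ i - 1 ∣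
  dist-> i {j} R<j with <-cmp j R
  ... | tri< _ _ j≯R = contradiction R<j j≯R
  ... | tri≈ _ _ j≯R = contradiction R<j j≯R
  ... | tri> _ _ _ = refl

  Close-cast : ∀ {a a′ b b′} → a ≡ a′ → b ≡ b′ → Close a′ b′ → Close a b
  Close-cast refl refl c = c

  Close-sym : ∀ {a b} → Close a b → Close b a
  Close-sym (p , q) = q , p

  ∣-∣-0-arc : ∀ i → arc ∣ i - 0 ∣ ≡ arc i
  ∣-∣-0-arc i = cong arc (∣-∣-identityʳ i)

  arc-flip : ∀ {a b} → a + b ≡ R → arc a ≡ arc b
  arc-flip {a} {b} a+b≡R = begin
    a ⊓ (R ∸ a) ≡⟨ cong (a ⊓_) (≡.trans (cong (_∸ a) (≡.sym a+b≡R)) (m+n∸m≡n a b)) ⟩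
    a ⊓ b       ≡⟨ ⊓-comm a b ⟩
    b ⊓ a       ≡⟨ cong (b ⊓_) (≡.trans (cong (_∸ b) (≡.sym a+b≡R)) (m+n∸n≡m a b)) ⟨
    b ⊓ (R ∸ b) ∎
    where open ≡.≡-Reasoning

  dist-link : ∀ {i j k} → i < R → Link j k → Close (dist i j) (dist i k)
  dist-link {i} {j} _ (next k<R) =
    Close-cast (dist-< i (<⇒≤ k<R)) (dist-< i k<R) (arc-close (∣-∣-close i j))
  dist-link {i} {_} {k} i<R (hub R≤) = Close-cast
    (≡.trans (dist-< i 0<R) (∣-∣-0-arc i)) refl (to k R≤)
    where
    to : ∀ k → R ≤ suc k → Close (arc i) (dist i k)
    to k R≤ with <-cmp k R
    ... | tri≈ _ _ _ = m≤n⇒m≤1+n (n≤1+n _) , ≤-refl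
    ... | tri> _ _ _ = subst (λ a → Close a (arc ∣ i - 1 ∣)) (∣-∣-0-arc i) (arc-close (∣-∣-close i 0))
    -- The closing edge: `k` is `R ∸ 1`, so `i` and `suc (k ∸ i)` sum to `R`, and `arc i` may be
    -- measured the other way round.
    ... | tri< k<R _ _ = Close-cast {a′ = arc (suc (k ∸ i))} (arc-flip i+≡R)
      (cong arc (m≤n⇒∣m-n∣≡n∸m i≤k))
      (arc-close (≤-refl , m≤n⇒m≤1+n (n≤1+n _)))
      where
      i≤k : i ≤ k
      i≤k = ≤-pred (≤-trans i<R R≤)
      i+≡R : i + suc (k ∸ i) ≡ R
      i+≡R = ≡.trans (+-suc i (k ∸ i)) (≡.trans (cong suc (m+[n∸m]≡n i≤k)) (≤-antisym k<R R≤))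
  dist-link {i} _ (twin R<k) =
    Close-cast (dist-< i (≤-trans (s≤s (s≤s (s≤s z≤n))) 4≤R)) (dist-> i R<k)
      (Close-sym (arc-close (∣-∣-close i 1)))

  dist-lipschitz : ∀ {i} → i < R → ∀ {u v} → Adj G u v → dist i (toℕ v) ≤ suc (dist i (toℕ u))
  dist-lipschitz i<R (inj₁ e) = proj₂ (dist-link i<R e)
  dist-lipschitz i<R (inj₂ e) = proj₁ (dist-link i<R e)

  -- Only `dist i` must vanish at `u`, so `u` may also be a twin when `i` is 1.
  far : ∀ {i u v} → i < R → dist i (toℕ u) ≡ 0 → Far G (dist i (toℕ v)) u v
  far {i} {u} {v} i<R d≡0 k p = subst (dist i (toℕ v) ≤_) (≡.trans (cong (k +_) d≡0) (+-identityʳ k))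
    (lipschitz (dist i ∘ toℕ) (dist-lipschitz i<R) p)

  vertex : ∀ {i} → i < R → Fin n
  vertex i<R = fromℕ< (≤-trans i<R (m≤m+n R (suc m)))

  toℕ-vertex : ∀ {i} (i<R : i < R) → toℕ (vertex i<R) ≡ i
  toℕ-vertex i<R = Fin.toℕ-fromℕ< _

  arc-r : arc r ≡ r
  arc-r = m≤n⇒m⊓n≡m (≤-reflexive (≡.sym (≡.trans (cong (_∸ r) R≡r+r) (m+n∸n≡m r r))))

  -- Either `i ∸ r` or `i + r` stays on the cycle; `i ≡ r` is split off in the second branch because
  -- `r + r` is already `R`.
  antipode : ∀ {i} → i < R → ∃ λ j → j < R × arc ∣ i - j ∣ ≡ r
  antipode {i} i<R with ≤-total r i
  ... | inj₁ r≤i = i ∸ r , ≤-trans (s≤s (m∸n≤m i r)) i<R ,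
    ≡.trans (cong arc (≡.trans (∣-∣-comm i _)
      (≡.trans (m≤n⇒∣m-n∣≡n∸m (m∸n≤m i r)) (m∸[m∸n]≡n r≤i)))) arc-r
  ... | inj₂ i≤r with m≤n⇒m<n∨m≡n i≤r
  ... | inj₁ i<r = i + r , subst (i + r <_) (≡.sym R≡r+r) (+-monoˡ-< r i<r) ,
    ≡.trans (cong arc (≡.trans (m≤n⇒∣m-n∣≡n∸m (m≤m+n i r)) (m+n∸m≡n i r))) arc-r
  ... | inj₂ refl = 0 , 0<R , ≡.trans (∣-∣-0-arc r) arc-r

  far-antipode : ∀ {i u} → i < R → dist i (toℕ u) ≡ 0 → ∃ (Far G r u)
  far-antipode {i} {u} i<R d≡0 with antipode i<R
  ... | j , j<R , arc≡r = vertex j<R , subst (λ l → Far G l u (vertex j<R))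
    (≡.trans (cong (dist i) (toℕ-vertex j<R)) (≡.trans (dist-< i j<R) arc≡r)) (far i<R d≡0)

  dist-self : ∀ {i} → i < R → dist i i ≡ 0
  dist-self {i} i<R = ≡.trans (dist-< i i<R) (cong arc (∣n-n∣≡0 i))

  -- Upper bounds on distances

  -- `o` is the hub 0, `a` its antipode and `p` the pendant vertex; `a` and `p` will be the
  -- non-central pair.
  o a p : Fin n
  o = vertex 0<R
  a = vertex r<R
  p = fromℕ< (m<m+n R (s≤s z≤n))

  toℕ-o : toℕ o ≡ 0
  toℕ-o = toℕ-vertex 0<R

  toℕ-p : toℕ p ≡ R
  toℕ-p = Fin.toℕ-fromℕ< _

  -- This covers the closing edge of the cycle, the pendant edge and the edges from 0 to the twins.
  hub-adj : ∀ {v} → R ≤ suc (toℕ v) → Adj G o v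
  hub-adj {v} R≤ = inj₁ (subst (λ i → Link i (toℕ v)) (≡.sym toℕ-o) (hub R≤))

  along : ∀ k {u v} → k + toℕ u ≡ toℕ v → toℕ v < R → Walk G u v k
  along zero eq v<R with Fin.toℕ-injective eq
  ... | refl = here
  along (suc k) {u} {v} eq v<R = step
    (inj₁ (subst (Link (toℕ u)) (≡.sym (toℕ-vertex u+1<R)) (next u+1<R)))
    (along k (≡.trans (cong (k +_) (toℕ-vertex u+1<R)) (≡.trans (+-suc k (toℕ u)) eq)) v<R)
    where
    u+1<R : suc (toℕ u) < R
    u+1<R = ≤-trans (s≤s (subst (suc (toℕ u) ≤_) eq (s≤s (m≤n+m (toℕ u) k)))) v<R

  -- Cross the closing edge from 0, then descend along the cycle to `v`.
  around : ∀ k {v} → k + suc (toℕ v) ≡ R → Walk G o v (suc k)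
  around k {v} eq = step (hub-adj (≤-reflexive (≡.sym last≡)))
    (reverse (along k (≡.sym (toℕ-vertex last<R)) (subst (_< R) (≡.sym (toℕ-vertex last<R)) last<R)))
    where
    last<R : k + toℕ v < R
    last<R = ≤-reflexive (≡.trans (≡.sym (+-suc k (toℕ v))) eq)
    last≡ : suc (toℕ (vertex last<R)) ≡ R
    last≡ = ≡.trans (cong suc (toℕ-vertex last<R)) (≡.trans (≡.sym (+-suc k (toℕ v))) eq)

  cycle-near-≤ : ∀ {u v} → toℕ u ≤ toℕ v → toℕ v < R → Near G r u v
  cycle-near-≤ {u} {v} u≤v v<R with toℕ v ∸ toℕ u ≤? r
  ... | yes t≤r = toℕ v ∸ toℕ u , t≤r , along _ (m∸n+n≡m u≤v) v<R
  -- If the direct arc is longer than `r`, the complementary arc through 0 is shorter than `r`.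
  ... | no t≰r = toℕ u + suc s , short ,
    reverse (along (toℕ u) (≡.trans (cong (toℕ u +_) toℕ-o) (+-identityʳ _)) (≤-trans (s≤s u≤v) v<R))
      ++ around s (m∸n+n≡m v<R)
    where
    open ≤-Reasoning
    s t : ℕ
    s = R ∸ suc (toℕ v)
    t = toℕ v ∸ toℕ u
    short : toℕ u + suc s ≤ r
    short = +-cancelʳ-≤ r _ _ (begin
      toℕ u + suc s + r   ≤⟨ +-monoʳ-≤ (toℕ u + suc s) (<⇒≤ (≰⇒> t≰r)) ⟩
      toℕ u + suc s + t   ≡⟨ cong (_+ t) (+-comm (toℕ u) (suc s)) ⟩
      suc s + toℕ u + t   ≡⟨ +-assoc (suc s) (toℕ u) t ⟩
      suc s + (toℕ u + t) ≡⟨ cong (suc s +_) (m+[n∸m]≡n u≤v) ⟩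
      suc s + toℕ v       ≡⟨ +-suc s (toℕ v) ⟨
      s + suc (toℕ v)     ≡⟨ m∸n+n≡m v<R ⟩
      R                   ≡⟨ R≡r+r ⟩
      r + r               ∎)

  cycle-near : ∀ {u v} → toℕ u < R → toℕ v < R → Near G r u v
  cycle-near {u} {v} u<R v<R with ≤-total (toℕ u) (toℕ v)
  ... | inj₁ u≤v = cycle-near-≤ u≤v v<R
  ... | inj₂ v≤u = Near-sym (cycle-near-≤ v≤u u<R)

  -- Only the antipode of 0 is at distance `r`; the strict bound leaves room for the pendant edge.
  cycle-near-o : ∀ {v} → toℕ v < R → toℕ v ≢ r → ∃ λ k → k < r × Walk G v o k
  cycle-near-o {v} v<R v≢r with <-cmp (toℕ v) r
  ... | tri< v<r _ _ = toℕ v , v<r ,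
    reverse (along (toℕ v) (≡.trans (cong (toℕ v +_) toℕ-o) (+-identityʳ _)) v<R)
  ... | tri≈ _ v≡r _ = contradiction v≡r v≢r
  ... | tri> _ _ r<v = suc (R ∸ suc (toℕ v)) , short , reverse (around _ (m∸n+n≡m v<R))
    where
    open ≤-Reasoning
    short : suc (R ∸ suc (toℕ v)) < r
    short = begin-strict
      suc (R ∸ suc (toℕ v)) ≡⟨ +-∸-assoc 1 v<R ⟨
      R ∸ toℕ v             <⟨ ∸-monoʳ-< r<v (<⇒≤ v<R) ⟩
      R ∸ r                 ≡⟨ cong (_∸ r) R≡r+r ⟩
      r + r ∸ r             ≡⟨ m+n∸n≡m r r ⟩
      r                     ∎

  cycle-near-p : ∀ {v} → toℕ v < R → toℕ v ≢ r → Near G r v p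
  cycle-near-p v<R v≢r with cycle-near-o v<R v≢r
  ... | k , k<r , w = suc k , k<r , snoc w (hub-adj {p} (m≤n⇒m≤1+n (≤-reflexive (≡.sym toℕ-p))))

  twin-adj : ∀ {t u v} → R < toℕ t → toℕ u ≡ 1 → Adj G u v → Adj G t v
  twin-adj {t} {u} {v} R<t u≡1 e = go (subst (λ i → Link i (toℕ v) ⊎ Link (toℕ v) i) u≡1 e)
    where
    go : ∀ {j} → Link 1 j ⊎ Link j 1 → Link (toℕ t) j ⊎ Link j (toℕ t)
    go (inj₁ (next _)) = inj₂ (twin R<t)
    go (inj₂ (next _)) = inj₂ (hub (m≤n⇒m≤1+n (<⇒≤ R<t)))
    go (inj₂ (hub R≤2)) = contradiction (≤-trans 4≤R R≤2) λ { (s≤s (s≤s ())) }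
    go (inj₂ (twin R<1)) = contradiction (≤-trans 4≤R (<⇒≤ R<1)) λ { (s≤s ()) }

  near-via-o : ∀ {u v} → Adj G o u → Adj G o v → Near G r u v
  near-via-o {u} {v} e f = 2 , 2≤r , step (sym G {o} {u} e) (step f here)

  -- A walk from vertex 1 becomes a walk from the twin by replacing its first vertex.
  twin-near-cycle : ∀ {t v} → R < toℕ t → toℕ v < R → Near G r t v
  twin-near-cycle {t} {v} R<t v<R = go (toℕ-vertex 1<R)
    (cycle-near (subst (_< R) (≡.sym (toℕ-vertex 1<R)) 1<R) v<R)
    where
    go : ∀ {w} → toℕ w ≡ 1 → Near G r w v → Near G r t v
    -- The empty walk has no first edge to redirect; vertex 1 and its twin are joined through 0 in
    -- two steps.
    go w≡1 (_ , _ , here) = near-via-o (hub-adj (m≤n⇒m≤1+n (<⇒≤ R<t)))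
      (inj₁ (≡.subst₂ Link (≡.sym toℕ-o) (≡.sym w≡1) (next 1<R)))
    go w≡1 (k , k≤r , step {u = w} {v = v′} e q) =
      k , k≤r , step (twin-adj {t} {w} {v′} R<t w≡1 e) q

  hub-near : ∀ {u v} → R ≤ toℕ u → R ≤ toℕ v → Near G r u v
  hub-near {u} {v} R≤u R≤v = near-via-o {u} {v} (hub-adj (m≤n⇒m≤1+n R≤u)) (hub-adj (m≤n⇒m≤1+n R≤v))

  eccentricity-r : ∀ {v} → v ≢ a → v ≢ p → (∀ u → Near G r v u) × ∃ (Far G r v)
  eccentricity-r {v} v≢a v≢p with <-cmp (toℕ v) R
  ... | tri≈ _ v≡R _ = contradiction (Fin.toℕ-injective (≡.trans v≡R (≡.sym toℕ-p))) v≢p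
  -- A twin borrows the antipode of vertex 1, since `dist 1` vanishes on twins.
  ... | tri> _ _ R<v = near , far-antipode {u = v} 1<R (dist-> 1 R<v)
    where
    near : ∀ u → Near G r v u
    near u with toℕ u <? R
    ... | yes u<R = twin-near-cycle R<v u<R
    ... | no u≮R = hub-near (<⇒≤ R<v) (≮⇒≥ u≮R)
  ... | tri< v<R _ _ = near , far-antipode {u = v} v<R (dist-self v<R)
    where
    near : ∀ u → Near G r v u
    near u with <-cmp (toℕ u) R
    ... | tri< u<R _ _ = cycle-near v<R u<R
    ... | tri> _ _ R<u = Near-sym (twin-near-cycle R<u v<R)
    ... | tri≈ _ u≡R _ with Fin.toℕ-injective (≡.trans u≡R (≡.sym toℕ-p))
    ...   | refl = cycle-near-p v<R (λ v≡r →
      v≢a (Fin.toℕ-injective (≡.trans v≡r (≡.sym (toℕ-vertex r<R)))))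

  far-a-p : Far G (suc r) a p
  far-a-p = subst (λ l → Far G l a p)
    (≡.trans (cong (dist r) toℕ-p) (≡.trans (dist-R r) (cong suc arc-r)))
    (far {u = a} r<R (≡.trans (cong (dist r) (toℕ-vertex r<R)) (dist-self r<R)))

  -- The independent set and the extremal graph

  toℕ-≢ : ∀ {i j} {u v : Fin n} → toℕ u ≡ i → toℕ v ≡ j → i ≢ j → u ≢ v
  toℕ-≢ refl refl i≢j refl = i≢j refl

  link-leaves : ∀ {u v} → Link (toℕ u) (toℕ v) → u ∈ oddOrBeyond r (suc m) → v ∉ oddOrBeyond r (suc m)
  link-leaves {u} {v} e = go e refl refl
    where
    -- `hub` links start at 0 and `twin` links at 2, both even and below `R` as `2 ≤ r`.
    even : ∀ {r m} (u : Fin (r * 2 + m)) → 2 ≤ r → toℕ u ≡ 0 ⊎ toℕ u ≡ 2 → u ∉ oddOrBeyond r m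
    even {suc (suc _)} zero _ _ ()
    even {suc (suc _)} (suc (suc zero)) _ _ (there (there ()))
    even {suc (suc _)} (suc zero) _ (inj₁ ())
    even {suc (suc _)} (suc zero) _ (inj₂ ())
    even {suc (suc _)} (suc (suc (suc _))) _ (inj₁ ())
    even {suc (suc _)} (suc (suc (suc _))) _ (inj₂ ())
    even {suc zero} _ (s≤s ())

    go : ∀ {i j} → Link i j → toℕ u ≡ i → toℕ v ≡ j →
         u ∈ oddOrBeyond r (suc m) → v ∉ oddOrBeyond r (suc m)
    go (next k<R) refl v≡ = oddOrBeyond-next r v≡ (subst (_< R) (≡.sym v≡) k<R)
    go (hub _) u≡0 _ u∈ = contradiction u∈ (even u 2≤r (inj₁ u≡0))
    go (twin _) u≡2 _ u∈ = contradiction u∈ (even u 2≤r (inj₂ u≡2))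

  independent : Independent G (oddOrBeyond r (suc m))
  independent u v u∈ v∈ (inj₁ e) = link-leaves e u∈ v∈
  independent u v u∈ v∈ (inj₂ e) = link-leaves e v∈ u∈

  ∣independent∣ : ∣ oddOrBeyond r (suc m) ∣ ≡ n ∸ r
  ∣independent∣ = begin
    ∣ oddOrBeyond r (suc m) ∣ ≡⟨ ∣oddOrBeyond∣ r (suc m) ⟩
    r + suc m                 ≡⟨ m+n∸m≡n r (r + suc m) ⟨
    r + (r + suc m) ∸ r       ≡⟨ cong (_∸ r) (+-assoc r r (suc m)) ⟨
    r + r + suc m ∸ r         ≡⟨ cong (λ l → l + suc m ∸ r) R≡r+r ⟨
    n ∸ r                     ∎
    where open ≡.≡-Reasoning

  cycle-extremal : Extremal n r
  cycle-extremal = extremal G (≤-trans (s≤s z≤n) 2≤r)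
    (almostSelfCentered {x = a} {p}
      (o , toℕ-≢ toℕ-o (toℕ-vertex r<R) (<⇒≢ (≤-trans (s≤s z≤n) 2≤r)) ,
           toℕ-≢ toℕ-o toℕ-p (<⇒≢ 0<R))
      eccentricity-r far-a-p)
    (oddOrBeyond r (suc m) , independent , ∣independent∣)

-- Assembling both bounds

attained : ∀ {n r} → 2 ≤ r → 2 + r ≤ n → (3 ≤ r → r * 2 < n) → Extremal n r
attained {n} {r} 2≤r 2+r≤n 2r<n with r * 2 <? n
... | yes 2r<n = let m , eq = m≤n⇒∃[o]m+o≡n 2r<n in
  subst (λ n → Extremal n r) (≡.trans (+-suc (r * 2) m) eq) (Cycle.cycle-extremal r m 2≤r)
... | no 2r≮n with m≤n⇒m<n∨m≡n 2≤r
...   | inj₁ 3≤r = contradiction (2r<n 3≤r) 2r≮n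
-- For `r` = 2 the two bounds on the order force `n` to be 4.
...   | inj₂ refl = subst (λ n → Extremal n 2) (≤-antisym 2+r≤n (≮⇒≥ 2r≮n)) P₄.P₄-extremal

theorem6 : (n r : ℕ) → 2 ≤ r →
    ((G : Graph n) (a : ℕ) → AlmostSelfCentered G → Radius G r → IndepNum G a → a ≤ n ∸ r)
    × ((Σ (Graph n) λ G → AlmostSelfCentered G × Radius G r)
    → Σ (Graph n) λ G → AlmostSelfCentered G × Radius G r × IndepNum G (n ∸ r))
theorem6 n r 2≤r = upper , λ { (G , asc , rad) → attained 2≤r (order₁ asc rad) (order₂ asc rad) }
  where
  upper : (G : Graph n) (a : ℕ) → AlmostSelfCentered G → Radius G r → IndepNum G a → a ≤ n ∸ r
  upper G a (conn , _) rad ((S , ind , refl) , _) =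
    independent-≤ conn (≤-trans (s≤s z≤n) 2≤r) rad S ind

  order₁ : ∀ {G : Graph n} → AlmostSelfCentered G → Radius G r → 2 + r ≤ n
  order₁ asc rad = decidable-stable (2 + r ≤? n) (¬¬-map
    (λ D → PoleLayers.radius+2≤order (poles D 2≤r asc rad) 2≤r) (¬¬-distance (proj₁ asc)))

  order₂ : ∀ {G : Graph n} → AlmostSelfCentered G → Radius G r → 3 ≤ r → r * 2 < n
  order₂ asc rad 3≤r = decidable-stable (r * 2 <? n) (¬¬-map
    (λ D → PoleLayers.2radius<order (poles D 2≤r asc rad) 2≤r 3≤r) (¬¬-distance (proj₁ asc)))
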